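{- Let $\theta$ be an eigenvalue of a distance-regular graph $\Gamma$ with valency $k$ and diameter $3$, and let $u_0,u_1,u_2,u_3$ be its standard sequence. Then the following are equivalent: (i) $u_2(\theta)=0$; (ii) $\theta=a_3$; (iii) $\theta=\frac{a_1+\sqrt{a_1^2+4k}}{2}$. Moreover, if (i)–(iii) hold, then $\theta$ is the second largest eigenvalue of $\Gamma$.
   Context: A connected graph $\Gamma$ of diameter $D$ is distance-regular if there are integers $b_i,c_i$ ($0\le i\le D$) such that for any two vertices $x,y$ at distance $i$, exactly $c_i$ neighbours of $y$ are at distance $i-1$ from $x$ and exactly $b_i$ neighbours of $y$ are at distance $i+1$ from $x$. Then $\Gamma$ is regular of valency $k=b_0$, and $a_i:=k-b_i-c_i$. The eigenvalues of $\Gamma$ are those of its adjacency matrix. For an eigenvalue $\theta$, the standard sequence $u_i=u_i(\theta)$ ($0\le i\le D$) is defined by $u_0=1$, $u_1=\theta/k$, and $c_iu_{i-1}+a_iu_i+b_iu_{i+1}=\theta u_i$ for $1\le i\le D-1$ (and these recurrences, with $b_D=0$, also hold for $i=D$ when $\theta$ is an eigenvalue). -}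

module Defs where

open import Level using (Level; 0ℓ; _⊔_) renaming (suc to lsuc)
open import Algebra.Apartness.Bundles using (HeytingField)
import Algebra.Apartness.Properties.HeytingCommutativeRing as HeytingProperties
open import Algebra.Bundles using (CommutativeRing)
import Algebra.Definitions.RawMonoid as RawMonoidDefinitions
open import Data.Bool using (if_then_else_)
open import Data.Fin using (Fin)
open import Data.Fin.Properties using (any?) renaming (_≟_ to _≟ᶠ_)
open import Data.List using (length; filter; allFin)
open import Data.List.Membership.Propositional using (lose)
open import Data.List.Membership.Propositional.Properties using (∈-allFin)
open import Data.List.Properties using (filter-some)
open import Data.Nat as ℕ using (ℕ; zero; suc; NonZero; z≤n; s≤s)
open import Data.Nat.Properties using (allUpTo?)
open import Data.Product using (Σ-syntax; ∃₂; ∃-syntax; _×_; _,_; proj₁; proj₂)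
open import Data.Sum using (_⊎_; inj₁; inj₂)
open import Relation.Binary using (Rel; Decidable; Symmetric; Irreflexive; IsStrictPartialOrder)
open import Relation.Binary.PropositionalEquality using (_≡_; refl; subst)
open import Relation.Nullary using (does; ¬_; ¬?; _×-dec_)

-- The real numbers, presented axiomatically as a Cauchy complete Archimedean
-- ordered field.  Classically these axioms characterise ℝ up to unique
-- isomorphism; they do not assert that the order is decidable, so they also
-- hold of the constructive Cauchy reals.

record Reals (c ℓ₁ ℓ₂ ℓ₃ : Level) : Set (lsuc (c ⊔ ℓ₁ ⊔ ℓ₂ ⊔ ℓ₃)) where
  field
    heytingField : HeytingField c ℓ₁ ℓ₂

  open HeytingField heytingField public
    renaming (refl to ≈-refl; sym to ≈-sym; trans to ≈-trans)

  commutativeRing : CommutativeRing c ℓ₁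
  commutativeRing = record { isCommutativeRing = isCommutativeRing }

  open RawMonoidDefinitions (CommutativeRing.+-rawMonoid commutativeRing) public
    using (sum) renaming (_×_ to _ℕ×_)

  fromℕ : ℕ → Carrier
  fromℕ n = n ℕ× 1#

  infix 4 _<_

  field
    _<_                    : Rel Carrier ℓ₃
    <-isStrictPartialOrder : IsStrictPartialOrder _≈_ _<_
    #⇒<⊎>                  : ∀ {x y} → x # y → x < y ⊎ y < x
    <⇒#                    : ∀ {x y} → x < y → x # y
    0<1                    : 0# < 1#
    +-monoˡ-<              : ∀ {x y} z → x < y → x + z < y + z
    *-pos                  : ∀ {x y} → 0# < x → 0# < y → 0# < x * y
    archimedean            : ∀ x → ∃[ n ] x < fromℕ n

  open IsStrictPartialOrder <-isStrictPartialOrder public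
    using (<-resp-≈) renaming (irrefl to <-irrefl; trans to <-trans)

  infix 4 _≤_

  _≤_ : Rel Carrier ℓ₃
  x ≤ y = ¬ (y < x)

  -- ∣ x - y ∣ < ε
  Within : Carrier → Carrier → Carrier → Set ℓ₃
  Within ε x y = (x - y < ε) × (y - x < ε)

  Cauchy : (ℕ → Carrier) → Set (c ⊔ ℓ₃)
  Cauchy f = ∀ ε → 0# < ε →
    ∃[ N ] (∀ m n → N ℕ.≤ m → N ℕ.≤ n → Within ε (f m) (f n))

  _ConvergesTo_ : (ℕ → Carrier) → Carrier → Set (c ⊔ ℓ₃)
  f ConvergesTo x = ∀ ε → 0# < ε → ∃[ N ] (∀ n → N ℕ.≤ n → Within ε (f n) x)

  field
    complete : ∀ f → Cauchy f → ∃[ x ] f ConvergesTo x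

  0<fromℕ[1+n] : ∀ n → 0# < fromℕ (suc n)
  0<fromℕ[1+n] zero    = proj₁ <-resp-≈ (≈-sym (+-identityʳ 1#)) 0<1
  0<fromℕ[1+n] (suc n) = <-trans (0<fromℕ[1+n] n)
    (proj₂ <-resp-≈ (+-identityˡ _) (+-monoˡ-< (fromℕ (suc n)) 0<1))

  fromℕ#0 : ∀ n .{{_ : NonZero n}} → fromℕ n # 0#
  fromℕ#0 (suc n) = #-sym (<⇒# (0<fromℕ[1+n] n))

  infixl 7 _/_

  -- The library inverts fromℕ n - 0#.
  _/_ : Carrier → (n : ℕ) .{{_ : NonZero n}} → Carrier
  x / n = x * proj₁ (#⇒invertible (fromℕ#0 n))

  IsSqrt : Carrier → Carrier → Set (ℓ₁ ⊔ ℓ₃)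
  IsSqrt x s = (0# ≤ s) × (s * s ≈ x)

  -- "Nonzero" for a vector is the positive notion: some entry is apart from 0.
  IsEigenvalue : ∀ {n} → (Fin n → Fin n → Carrier) → Carrier → Set (c ⊔ ℓ₁ ⊔ ℓ₂)
  IsEigenvalue {n} M θ = Σ[ v ∈ (Fin n → Carrier) ]
    (∃[ i ] v i # 0#) × (∀ i → sum (λ j → M i j * v j) ≈ θ * v i)

  -- Second largest among the distinct eigenvalues.
  IsSecondLargestEigenvalue : ∀ {n} → (Fin n → Fin n → Carrier) → Carrier →
                              Set (c ⊔ ℓ₁ ⊔ ℓ₂ ⊔ ℓ₃)
  IsSecondLargestEigenvalue M θ = IsEigenvalue M θ ×
    Σ[ μ ∈ Carrier ] IsEigenvalue M μ × (θ < μ) × (∀ ν → IsEigenvalue M ν → ν ≈ μ ⊎ ν ≤ θ)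

record Graph : Set₁ where
  infix 4 _∼_ _∼?_
  field
    order    : ℕ
    _∼_      : Rel (Fin order) 0ℓ
    _∼?_     : Decidable _∼_
    ∼-sym    : Symmetric _∼_
    ∼-irrefl : Irreflexive _≡_ _∼_

  Vertex : Set
  Vertex = Fin order

  Walk : ℕ → Vertex → Vertex → Set
  Walk zero    x y = x ≡ y
  Walk (suc i) x y = ∃[ z ] x ∼ z × Walk i z y

  walk? : ∀ i → Decidable (Walk i)
  walk? zero    x y = x ≟ᶠ y
  walk? (suc i) x y = any? (λ z → (x ∼? z) ×-dec walk? i z y)

  Distance : ℕ → Vertex → Vertex → Set
  Distance i x y = Walk i x y × (∀ {j} → j ℕ.< i → ¬ Walk j x y)

  distance? : ∀ i → Decidable (Distance i)
  distance? i x y = walk? i x y ×-dec allUpTo? (λ j → ¬? (walk? j x y)) i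

  Connected : Set
  Connected = ∀ x y → ∃[ i ] Walk i x y

  HasDiameter : ℕ → Set
  HasDiameter D = (∀ {i x y} → Distance i x y → i ℕ.≤ D) ×
                  ∃₂ (λ x y → Distance D x y)

  -- The number of neighbours of y at distance i from x.
  neighboursAt : ℕ → Vertex → Vertex → ℕ
  neighboursAt i x y =
    length (filter (λ z → (y ∼? z) ×-dec distance? i x z) (allFin order))

-- Only the values b i and c i with i ≤ D matter.

record IsDistanceRegular (Γ : Graph) (D : ℕ) (b c : ℕ → ℕ) : Set where
  open Graph Γ
  field
    connected : Connected
    diameter  : HasDiameter D
    -- No vertex is at distance -1.
    c-zero    : c 0 ≡ 0
    c-count   : ∀ {i x y} → Distance (suc i) x y → neighboursAt i x y ≡ c (suc i)
    b-count   : ∀ {i x y} → Distance i x y → neighboursAt (suc i) x y ≡ b i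

  valency : ℕ
  valency = b 0

  walk⇒valency-nonZero : ∀ i .{{_ : NonZero i}} {x y} → Walk i x y → NonZero valency
  walk⇒valency-nonZero (suc i) {x} (z , x∼z , _) =
    ℕ.>-nonZero (subst (0 ℕ.<_) (b-count (refl , λ ()))
      (filter-some (λ w → (x ∼? w) ×-dec distance? 1 x w) (lose (∈-allFin z) (x∼z , d₁))))
    where
    d₁ : Distance 1 x z
    d₁ = (z , x∼z , refl) , λ where (s≤s z≤n) x≡z → ∼-irrefl x≡z x∼z

  valency-nonZero : .{{_ : NonZero D}} → NonZero valency
  valency-nonZero = walk⇒valency-nonZero D (proj₁ (proj₂ (proj₂ (proj₂ diameter))))

module _ {r ℓ₁ ℓ₂ ℓ₃} (ℝ : Reals r ℓ₁ ℓ₂ ℓ₃) where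
  open Reals ℝ

  adjacencyMatrix : (Γ : Graph) → Graph.Vertex Γ → Graph.Vertex Γ → Carrier
  adjacencyMatrix Γ x y = if does (Graph._∼?_ Γ x y) then 1# else 0#

  module _ {Γ : Graph} {D : ℕ} .{{_ : NonZero D}} {b c : ℕ → ℕ}
           (dr : IsDistanceRegular Γ D b c) where
    open IsDistanceRegular dr using (valency; valency-nonZero)

    -- a i = k - b i - c i, the subtraction being that of ℝ.
    intersectionNumberA : ℕ → Carrier
    intersectionNumberA i = fromℕ valency - fromℕ (b i) - fromℕ (c i)

    -- Only the values u i with i ≤ D matter.
    record IsStandardSequence (θ : Carrier) (u : ℕ → Carrier) : Set ℓ₁ where
      field
        u₀         : u 0 ≈ 1#
        u₁         : u 1 ≈ _/_ θ valency {{valency-nonZero}}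
        recurrence : ∀ i → suc i ℕ.< D →
          fromℕ (c (suc i)) * u i
            + intersectionNumberA (suc i) * u (suc i)
            + fromℕ (b (suc i)) * u (suc (suc i))
          ≈ θ * u (suc i)

-- Normalise an eigenvector of θ to be 1 at a vertex x and let Sᵢ be the sum of its entries over
-- the vertices at distance i from x.  Then S₀ = 1, S₁ = θ and
--   θ S₁ = k + a₁ S₁ + c₂ S₂,   θ S₂ = b₁ S₁ + a₂ S₂ + c₃ S₃,   θ S₃ = b₂ S₂ + a₃ S₃.
-- Moreover c₂ S₂ = k b₁ u₂, so u₂ = 0 iff S₂ = 0 iff θ² = k + a₁ θ.  If S₂ = 0 then S₃ = 0 would
-- force θ = 0, which is not a root of the quadratic; so the last equation gives θ = a₃ ≥ 0, and θ is
-- the positive root.  Finally, an eigenvalue ν > θ has all Sᵢ > 0, whereas adding up the equations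
-- gives ν ΣSᵢ = k ΣSᵢ, so ν = k.
module Submission where

open import Defs
open import Algebra.Bundles using (CommutativeRing)
import Algebra.Properties.Ring as RingProperties
import Algebra.Properties.Semiring.Sum as SemiringSum
import Algebra.Solver.Ring.NaturalCoefficients.Default as SemiringSolver
import Algebra.Apartness.Properties.HeytingCommutativeRing as HeytingProperties
open import Data.Bool using (if_then_else_)
open import Data.Empty using (⊥; ⊥-elim)
open import Data.Fin as Fin using (Fin)
open import Data.Fin.Properties as Fin using ()
open import Data.List using (length; filter; tabulate)
open import Data.List.Membership.Propositional using (lose)
open import Data.List.Membership.Propositional.Properties using (∈-allFin)
open import Data.List.Properties using (filter-some)
open import Data.Nat as ℕ using (ℕ; zero; suc; NonZero)
import Data.Nat.Properties as ℕ
open import Data.Nat.Induction using (<-rec)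
open import Data.Product using (∃-syntax; _×_; _,_; proj₁; proj₂)
open import Data.Sum using (_⊎_; inj₁; inj₂; [_,_]′)
open import Function using (_∘_; id)
open import Function.Bundles using (_⇔_; mk⇔)
open import Level using (Level; _⊔_)
open import Relation.Binary using (tri<; tri≈; tri>)
open import Relation.Binary.PropositionalEquality as ≡ using (_≡_; _≢_)
import Relation.Binary.Reasoning.Setoid as SetoidReasoning
open import Relation.Nullary using (Dec; yes; no; does; ¬_; contradiction; _×-dec_)
open import Relation.Unary using (Pred) renaming (Decidable to Decidable₁)

private variable
  r ℓ₁ ℓ₂ ℓ₃ p q : Level

-- Walks, geodesics and distance in a graph.

module GraphDistance (Γ : Graph) where
  open Graph Γ

  private variable
    i j : ℕ
    x y z : Vertex

  walk-snoc : ∀ i → Walk i x y → y ∼ z → Walk (suc i) x z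
  walk-snoc zero    ≡.refl        y∼z = _ , y∼z , ≡.refl
  walk-snoc (suc i) (w , x∼w , p) y∼z = w , x∼w , walk-snoc i p y∼z

  walk-sym : ∀ i → Walk i x y → Walk i y x
  walk-sym zero    ≡.refl        = ≡.refl
  walk-sym (suc i) (w , x∼w , p) = walk-snoc i (walk-sym i p) (∼-sym x∼w)

  distance-unique : Distance i x y → Distance j x y → i ≡ j
  distance-unique {i} {j = j} (p , p-min) (q , q-min) with ℕ.<-cmp i j
  ... | tri< i<j _ _ = contradiction p (q-min i<j)
  ... | tri≈ _ i≡j _ = i≡j
  ... | tri> _ _ j<i = contradiction q (p-min j<i)

  -- Strong induction on the length: `walk?` decides whether a shorter walk exists, and a walk with
  -- no shorter one realises the distance.
  walk⇒distance : ∀ i → Walk i x y → ∃[ j ] Distance j x y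
  walk⇒distance {x} {y} = <-rec _ λ i shorten p → shortest i shorten p (ℕ.anyUpTo? (λ j → walk? j x y) i)
    where
    shortest : ∀ i → (∀ {j} → j ℕ.< i → Walk j x y → ∃[ l ] Distance l x y) → Walk i x y →
               Dec (∃[ j ] j ℕ.< i × Walk j x y) → ∃[ l ] Distance l x y
    shortest i shorten p (yes (j , j<i , q)) = shorten j<i q
    shortest i shorten p (no ∄)              = i , p , λ j<i q → ∄ (_ , j<i , q)

  distance-zero : Distance 0 x x
  distance-zero = ≡.refl , λ ()

  distance-one : x ∼ y → Distance 1 x y
  distance-one x∼y = (_ , x∼y , ≡.refl) , λ where (ℕ.s≤s ℕ.z≤n) x≡y → ∼-irrefl x≡y x∼y

  distance-step : Distance i x y → y ∼ z → Distance j x z → j ℕ.≤ suc i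
  distance-step {i} (p , _) y∼z (_ , q-min) = ℕ.≮⇒≥ λ 1+i<j → q-min 1+i<j (walk-snoc i p y∼z)

  -- Take `z` next to `y` on a reversed shortest walk; a walk to `z` shorter than `i` would extend
  -- over the edge to a walk to `y` that is too short.
  distance-pred : Distance (suc i) x y → ∃[ z ] y ∼ z × Distance i x z
  distance-pred {i} (p , p-min) with walk-sym (suc i) p
  ... | z , y∼z , q = z , y∼z , walk-sym i q ,
    λ {j} j<i w → p-min (ℕ.s<s j<i) (walk-snoc j w (∼-sym y∼z))

-- Arithmetic, order and finite sums over the reals.

module RealProperties (ℝ : Reals r ℓ₁ ℓ₂ ℓ₃) where
  open Reals ℝ
  open CommutativeRing commutativeRing public
    using (ring; semiring; commutativeSemiring)
  open RingProperties ring public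
    using (-‿distribʳ-*; //-rightDividesˡ; [y-z]x≈yx-zx; x∙y⁻¹≈ε⇒x≈y; +-cancelˡ; +-cancelʳ)
  open HeytingProperties heytingCommutativeRing public
    using (x-0≈x; 1#0; invertibleˡ⇒#)
  open SemiringSum semiring public
    using (sum-cong-≋; ∑-comm; ∑-distrib-+; *-distribˡ-sum; *-distribʳ-sum)
  open SetoidReasoning setoid

  -- Apartness makes `x - y` invertible, and `x - y` annihilates `z`. Serves whenever a quantity
  -- satisfies an eigenvalue equation for two numbers that are apart.
  #∧*-equal⇒≈0 : ∀ {x y z} → x # y → x * z ≈ y * z → z ≈ 0#
  #∧*-equal⇒≈0 {x} {y} {z} x#y xz≈yz with #⇒invertible x#y
  ... | w , w[x-y]≈1 , _ = begin
    z                   ≈⟨ *-identityˡ z ⟨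
    1# * z              ≈⟨ *-congʳ w[x-y]≈1 ⟨
    w * (x - y) * z     ≈⟨ *-assoc w (x - y) z ⟩
    w * ((x - y) * z)   ≈⟨ *-congˡ ([y-z]x≈yx-zx z x y) ⟩
    w * (x * z - y * z) ≈⟨ *-congˡ (+-congʳ xz≈yz) ⟩
    w * (y * z - y * z) ≈⟨ *-congˡ (-‿inverseʳ (y * z)) ⟩
    w * 0#              ≈⟨ zeroʳ w ⟩
    0#                  ∎

  x*y≈0⇒y≈0 : ∀ {x y} → x # 0# → x * y ≈ 0# → y ≈ 0#
  x*y≈0⇒y≈0 {y = y} x#0 xy≈0 = #∧*-equal⇒≈0 x#0 (≈-trans xy≈0 (≈-sym (zeroˡ y)))

  *-cancelˡ : ∀ {x y z} → x # 0# → x * y ≈ x * z → y ≈ z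
  *-cancelˡ {x} {y} {z} x#0 xy≈xz = x∙y⁻¹≈ε⇒x≈y _ _ (x*y≈0⇒y≈0 x#0 (begin
    x * (y - z)         ≈⟨ distribˡ x y (- z) ⟩
    x * y + x * - z     ≈⟨ +-cong xy≈xz (≈-sym (-‿distribʳ-* x z)) ⟩
    x * z - x * z       ≈⟨ -‿inverseʳ (x * z) ⟩
    0#                  ∎))

  -- An inverse of `x * y`, multiplied by `x`, inverts `y`. This gives apartness constructively,
  -- where refuting `y ≈ 0#` would not suffice.
  x*y#0⇒y#0 : ∀ {x y} → x * y # 0# → y # 0#
  x*y#0⇒y#0 {x} {y} xy#0 with #⇒invertible xy#0
  ... | w , w[xy-0]≈1 , _ = invertibleˡ⇒# (w * x , (begin
    w * x * (y - 0#)   ≈⟨ *-congˡ (x-0≈x y) ⟩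
    w * x * y          ≈⟨ *-assoc w x y ⟩
    w * (x * y)        ≈⟨ *-congˡ (x-0≈x (x * y)) ⟨
    w * (x * y - 0#)   ≈⟨ w[xy-0]≈1 ⟩
    1#                 ∎))

  #0⇒inverse : ∀ {x} → x # 0# → ∃[ y ] x * y ≈ 1#
  #0⇒inverse {x} x#0 with #⇒invertible x#0
  ... | y , _ , [x-0]y≈1 = y , ≈-trans (*-congʳ (≈-sym (x-0≈x x))) [x-0]y≈1

  /-*-cancel : ∀ x n .{{_ : NonZero n}} → x / n * fromℕ n ≈ x
  /-*-cancel x n with #⇒invertible (fromℕ#0 n)
  ... | y , y[n-0]≈1 , _ = begin
    x * y * fromℕ n         ≈⟨ *-assoc x y (fromℕ n) ⟩
    x * (y * fromℕ n)       ≈⟨ *-congˡ (*-congˡ (x-0≈x (fromℕ n))) ⟨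
    x * (y * (fromℕ n - 0#)) ≈⟨ *-congˡ y[n-0]≈1 ⟩
    x * 1#                  ≈⟨ *-identityʳ x ⟩
    x                       ∎

  <-respˡ-≈ : ∀ {x y z} → x ≈ y → x < z → y < z
  <-respˡ-≈ = proj₂ <-resp-≈

  <-respʳ-≈ : ∀ {x y z} → x ≈ y → z < x → z < y
  <-respʳ-≈ = proj₁ <-resp-≈

  0<⇒#0 : ∀ {x} → 0# < x → x # 0#
  0<⇒#0 = #-sym ∘ <⇒#

  0≤∧#0⇒0< : ∀ {x} → 0# ≤ x → x # 0# → 0# < x
  0≤∧#0⇒0< 0≤x x#0 = [ ⊥-elim ∘ 0≤x , id ]′ (#⇒<⊎> x#0)

  0<⇒≉0 : ∀ {x} → 0# < x → ¬ x ≈ 0#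
  0<⇒≉0 0<x x≈0 = <-irrefl (≈-sym x≈0) 0<x

  x<x+y : ∀ x {y} → 0# < y → x < x + y
  x<x+y x {y} 0<y = <-respˡ-≈ (+-identityˡ x) (<-respʳ-≈ (+-comm y x) (+-monoˡ-< x 0<y))

  +-pos : ∀ {x y} → 0# < x → 0# < y → 0# < x + y
  +-pos 0<x 0<y = <-trans 0<x (x<x+y _ 0<y)

  x<y⇒0<y-x : ∀ {x y} → x < y → 0# < y - x
  x<y⇒0<y-x {x} x<y = <-respˡ-≈ (-‿inverseʳ x) (+-monoˡ-< (- x) x<y)

  -- The order is not assumed decidable, so `y # 0#` comes first, from `x * y # 0#`. A negative `y`
  -- would then make both `x * y` and its negative positive.
  *-cancelˡ-pos : ∀ {x y} → 0# < x → 0# < x * y → 0# < y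
  *-cancelˡ-pos {x} {y} 0<x 0<xy with #⇒<⊎> (x*y#0⇒y#0 (0<⇒#0 0<xy))
  ... | inj₂ 0<y = 0<y
  ... | inj₁ y<0 = ⊥-elim (<-irrefl (≈-sym (-‿inverseʳ (x * y)))
    (+-pos 0<xy (<-respʳ-≈ (begin
      x * (0# - y)  ≈⟨ *-congˡ (+-identityˡ (- y)) ⟩
      x * - y       ≈⟨ -‿distribʳ-* x y ⟨
      - (x * y)     ∎) (*-pos 0<x (x<y⇒0<y-x y<0)))))

  0<fromℕ : ∀ n .{{_ : NonZero n}} → 0# < fromℕ n
  0<fromℕ (suc n) = 0<fromℕ[1+n] n

  0≤fromℕ : ∀ n → 0# ≤ fromℕ n
  0≤fromℕ zero    = <-irrefl ≈-refl
  0≤fromℕ (suc n) = λ n<0 → <-irrefl ≈-refl (<-trans (0<fromℕ[1+n] n) n<0)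

  sum-zero : ∀ {n} {f : Fin n → Carrier} → (∀ i → f i ≈ 0#) → sum f ≈ 0#
  sum-zero {zero}  f≈0 = ≈-refl
  sum-zero {suc n} f≈0 = ≈-trans (+-cong (f≈0 Fin.zero) (sum-zero (f≈0 ∘ Fin.suc))) (+-identityˡ 0#)

  sum-single : ∀ {n} {f : Fin n → Carrier} i → (∀ j → i ≢ j → f j ≈ 0#) → sum f ≈ f i
  sum-single Fin.zero f≈0 =
    ≈-trans (+-congˡ (sum-zero λ j → f≈0 (Fin.suc j) λ ())) (+-identityʳ _)
  sum-single (Fin.suc i) f≈0 =
    ≈-trans (+-cong (f≈0 Fin.zero λ ()) (sum-single i λ j i≢j → f≈0 (Fin.suc j) (i≢j ∘ Fin.suc-injective)))
            (+-identityˡ _)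

  indicator : {P : Set p} → Dec P → Carrier
  indicator P? = if does P? then 1# else 0#

  indicator-yes : {P : Set p} (P? : Dec P) → P → indicator P? ≈ 1#
  indicator-yes (yes _) _ = ≈-refl
  indicator-yes (no ¬p) p = contradiction p ¬p

  indicator-no : {P : Set p} (P? : Dec P) → ¬ P → indicator P? ≈ 0#
  indicator-no (yes p) ¬p = contradiction p ¬p
  indicator-no (no _)  _  = ≈-refl

  indicator-× : {P : Set p} {Q : Set q} (P? : Dec P) (Q? : Dec Q) →
                indicator (P? ×-dec Q?) ≈ indicator P? * indicator Q?
  indicator-× (yes _) (yes _) = ≈-sym (*-identityˡ 1#)
  indicator-× (yes _) (no _)  = ≈-sym (*-identityˡ 0#)
  indicator-× (no _)  Q?      = ≈-sym (zeroˡ (indicator Q?))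

  -- Turns counting into summation. The function `f` is arbitrary because the induction shifts it by
  -- `Fin.suc`.
  fromℕ-length-filter : ∀ {a} {A : Set a} {P : Pred A p} (P? : Decidable₁ P) {n} (f : Fin n → A) →
                        fromℕ (length (filter P? (tabulate f))) ≈ sum (indicator ∘ P? ∘ f)
  fromℕ-length-filter P? {zero}  f = ≈-refl
  fromℕ-length-filter P? {suc n} f with P? (f Fin.zero)
  ... | yes _ = +-congˡ (fromℕ-length-filter P? (f ∘ Fin.suc))
  ... | no  _ = ≈-trans (fromℕ-length-filter P? (f ∘ Fin.suc)) (≈-sym (+-identityˡ _))

-- Distance matrices, neighbour counts and their recurrence.

module DistanceSums (ℝ : Reals r ℓ₁ ℓ₂ ℓ₃) {Γ : Graph} {D : ℕ} .{{_ : NonZero D}} {b c : ℕ → ℕ}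
                    (dr : IsDistanceRegular Γ D b c) where
  open Reals ℝ
  open RealProperties ℝ
  open Graph Γ
  open GraphDistance Γ
  open IsDistanceRegular dr
  open SetoidReasoning setoid
  open SemiringSolver commutativeSemiring using (solve; _:=_; _:+_; _:*_; con)

  private variable
    i j : ℕ
    x y z : Vertex

  private
    A : Vertex → Vertex → Carrier
    A = adjacencyMatrix ℝ Γ

    a : ℕ → Carrier
    a = intersectionNumberA ℝ dr

    N : ℕ → Vertex → Vertex → Carrier
    N i x z = fromℕ (neighboursAt i x z)

  distanceMatrix : ℕ → Vertex → Vertex → Carrier
  distanceMatrix i x y = indicator (distance? i x y)

  adjacent : x ∼ y → A x y ≈ 1#
  adjacent {x} {y} = indicator-yes (x ∼? y)

  nonadjacent : ¬ x ∼ y → A x y ≈ 0#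
  nonadjacent {x} {y} = indicator-no (x ∼? y)

  adjacencyMatrix-sym : ∀ x y → A x y ≈ A y x
  adjacencyMatrix-sym x y with x ∼? y
  ... | yes x∼y = ≈-sym (adjacent (∼-sym x∼y))
  ... | no  x≁y = ≈-sym (nonadjacent (x≁y ∘ ∼-sym))

  at-distance : ∀ {i x y} → Distance i x y → distanceMatrix i x y ≈ 1#
  at-distance = indicator-yes (distance? _ _ _)

  not-at-distance : ∀ {i x y} → ¬ Distance i x y → distanceMatrix i x y ≈ 0#
  not-at-distance = indicator-no (distance? _ _ _)

  at-other-distance : ∀ j → Distance i x y → i ≢ j → distanceMatrix j x y ≈ 0#
  at-other-distance j d i≢j = not-at-distance (i≢j ∘ distance-unique d)

  distance-total : ∀ x y → ∃[ i ] Distance i x y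
  distance-total x y = let i , p = connected x y in walk⇒distance i p

  -- Up to the symmetry of `A`, this makes the count an entry of the product of the `i`-th distance
  -- matrix with the adjacency matrix.
  neighboursAt-sum : ∀ i x z → N i x z ≈ sum (λ y → A z y * distanceMatrix i x y)
  neighboursAt-sum i x z = ≈-trans
    (fromℕ-length-filter (λ y → (z ∼? y) ×-dec distance? i x y) (λ y → y))
    (sum-cong-≋ λ y → indicator-× (z ∼? y) (distance? i x y))

  neighboursAt-none : (∀ {y} → z ∼ y → ¬ Distance i x y) → N i x z ≈ 0#
  neighboursAt-none {z} {i} {x} none = ≈-trans (neighboursAt-sum i x z) (sum-zero vanish)
    where
    vanish : ∀ y → A z y * distanceMatrix i x y ≈ 0#
    vanish y with z ∼? y
    ... | yes z∼y = ≈-trans (*-congˡ (not-at-distance (none z∼y))) (zeroʳ 1#)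
    ... | no  _   = zeroˡ _

  neighboursAt-pos : z ∼ y → Distance i x y → 0# < N i x z
  neighboursAt-pos {z} {y} {i} {x} z∼y d = 0<fromℕ _ {{ℕ.>-nonZero
    (filter-some (λ w → (z ∼? w) ×-dec distance? i x w) (lose (∈-allFin y) (z∼y , d)))}}

  fromℕ-cong : ∀ {m n} → m ≡ n → fromℕ m ≈ fromℕ n
  fromℕ-cong ≡.refl = ≈-refl

  neighboursAt-b : Distance i x z → N (suc i) x z ≈ fromℕ (b i)
  neighboursAt-b = fromℕ-cong ∘ b-count

  neighboursAt-c : Distance (suc i) x z → N i x z ≈ fromℕ (c (suc i))
  neighboursAt-c = fromℕ-cong ∘ c-count

  degree-sum : ∀ z → sum (A z) ≈ fromℕ valency
  degree-sum z = begin
    sum (A z)                                ≈⟨ sum-cong-≋ at-one ⟨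
    sum (λ y → A z y * distanceMatrix 1 z y) ≈⟨ neighboursAt-sum 1 z z ⟨
    N 1 z z                                  ≈⟨ neighboursAt-b distance-zero ⟩
    fromℕ valency                            ∎
    where
    at-one : ∀ y → A z y * distanceMatrix 1 z y ≈ A z y
    at-one y with z ∼? y
    ... | yes z∼y = ≈-trans (*-identityˡ _) (at-distance (distance-one z∼y))
    ... | no  _   = zeroˡ _

  a+c+b≈k : ∀ i → a i + fromℕ (c i) + fromℕ (b i) ≈ fromℕ valency
  a+c+b≈k i = ≈-trans (+-congʳ (//-rightDividesˡ (fromℕ (c i)) _)) (//-rightDividesˡ (fromℕ (b i)) _)

  three-term-cong : ∀ {α β γ s s′ t t′ u u′} → s ≈ s′ → t ≈ t′ → u ≈ u′ →
    α * s + β * t + γ * u ≈ α * s′ + β * t′ + γ * u′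
  three-term-cong s t u = +-cong (+-cong (*-congˡ s) (*-congˡ t)) (*-congˡ u)

  -- Exactly one indicator is 1 when `j` is one of the three distances, and none otherwise. Serves
  -- both to partition the neighbours of a vertex and to expand neighbour counts.
  three-term : ∀ i {w α β γ} → Distance j x y →
    (j ≡ i → w ≈ α) → (j ≡ suc i → w ≈ β) → (j ≡ 2 ℕ.+ i → w ≈ γ) →
    (j ≢ i → j ≢ suc i → j ≢ 2 ℕ.+ i → w ≈ 0#) →
    w ≈ α * distanceMatrix i x y + β * distanceMatrix (suc i) x y + γ * distanceMatrix (2 ℕ.+ i) x y
  three-term {j} {x} {y} i {w} {α} {β} {γ} d w≈α w≈β w≈γ w≈0
    with j ℕ.≟ i | j ℕ.≟ suc i | j ℕ.≟ 2 ℕ.+ i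
  ... | yes ≡.refl | _ | _ = begin
    w                         ≈⟨ w≈α ≡.refl ⟩
    α                         ≈⟨ solve 3 (λ α β γ → α := α :* con 1 :+ β :* con 0 :+ γ :* con 0) ≈-refl α β γ ⟩
    α * 1# + β * 0# + γ * 0#  ≈⟨ three-term-cong (at-distance d) (at-other-distance (suc i) d λ ()) (at-other-distance (2 ℕ.+ i) d λ ()) ⟨
    _                         ∎
  ... | no _ | yes ≡.refl | _ = begin
    w                         ≈⟨ w≈β ≡.refl ⟩
    β                         ≈⟨ solve 3 (λ α β γ → β := α :* con 0 :+ β :* con 1 :+ γ :* con 0) ≈-refl α β γ ⟩
    α * 0# + β * 1# + γ * 0#  ≈⟨ three-term-cong (at-other-distance i d λ ()) (at-distance d) (at-other-distance (2 ℕ.+ i) d λ ()) ⟨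
    _                         ∎
  ... | no _ | no _ | yes ≡.refl = begin
    w                         ≈⟨ w≈γ ≡.refl ⟩
    γ                         ≈⟨ solve 3 (λ α β γ → γ := α :* con 0 :+ β :* con 0 :+ γ :* con 1) ≈-refl α β γ ⟩
    α * 0# + β * 0# + γ * 1#  ≈⟨ three-term-cong (at-other-distance i d λ ()) (at-other-distance (suc i) d λ ()) (at-distance d) ⟨
    _                         ∎
  ... | no j≢i | no j≢1+i | no j≢2+i = begin
    w                         ≈⟨ w≈0 j≢i j≢1+i j≢2+i ⟩
    0#                        ≈⟨ solve 3 (λ α β γ → con 0 := α :* con 0 :+ β :* con 0 :+ γ :* con 0) ≈-refl α β γ ⟩
    α * 0# + β * 0# + γ * 0#  ≈⟨ three-term-cong (at-other-distance i d j≢i) (at-other-distance (suc i) d j≢1+i) (at-other-distance (2 ℕ.+ i) d j≢2+i) ⟨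
    _                         ∎

  -- The triangle inequality along the edge, in both directions: the distances of adjacent vertices
  -- from `x` differ by at most one.
  far : Distance (suc i) x z → z ∼ y → Distance j x y → j ≢ i → j ≢ suc i → j ≢ 2 ℕ.+ i → ⊥
  -- The innermost bound is `i ≤ j`; each excluded value raises it by one, up to `2 ℕ.+ i < j`,
  -- against `j ≤ 2 ℕ.+ i`.
  far d z∼y e j≢i j≢1+i j≢2+i = contradiction (distance-step d z∼y e)
    (ℕ.<⇒≱ (ℕ.≤∧≢⇒< (ℕ.≤∧≢⇒< (ℕ.≤∧≢⇒< (ℕ.s≤s⁻¹ (distance-step e (∼-sym z∼y) d))
      (j≢i ∘ ≡.sym)) (j≢1+i ∘ ≡.sym)) (j≢2+i ∘ ≡.sym)))

  -- Since `a` is defined by subtraction, its meaning as a count has to be derived: the valency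
  -- splits over the three possible distances, and the shares of `c` and `b` cancel.
  neighboursAt-a : Distance (suc i) x z → N (suc i) x z ≈ a (suc i)
  neighboursAt-a {i} {x} {z} d = +-cancelʳ _ _ _ (+-cancelʳ _ _ _ (begin
    N (suc i) x z + fromℕ (c (suc i)) + fromℕ (b (suc i))
      ≈⟨ solve 3 (λ a b c → a :+ c :+ b := c :+ a :+ b) ≈-refl _ _ _ ⟩
    fromℕ (c (suc i)) + N (suc i) x z + fromℕ (b (suc i))
      ≈⟨ +-cong (+-cong (≈-trans (≈-sym (neighboursAt-c d)) (neighboursAt-sum _ x z)) (neighboursAt-sum _ x z))
                (≈-trans (≈-sym (neighboursAt-b d)) (neighboursAt-sum _ x z)) ⟩
    sum (AD i) + sum (AD (suc i)) + sum (AD (2 ℕ.+ i))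
      ≈⟨ +-congʳ (∑-distrib-+ (AD i) (AD (suc i))) ⟨
    sum (λ y → AD i y + AD (suc i) y) + sum (AD (2 ℕ.+ i))
      ≈⟨ ∑-distrib-+ (λ y → AD i y + AD (suc i) y) (AD (2 ℕ.+ i)) ⟨
    sum (λ y → AD i y + AD (suc i) y + AD (2 ℕ.+ i) y)
      ≈⟨ sum-cong-≋ partition ⟨
    sum (A z)
      ≈⟨ degree-sum z ⟩
    fromℕ valency
      ≈⟨ a+c+b≈k (suc i) ⟨
    a (suc i) + fromℕ (c (suc i)) + fromℕ (b (suc i)) ∎))
    where
    AD : ℕ → Vertex → Carrier
    AD j y = A z y * distanceMatrix j x y

    partition : ∀ y → A z y ≈ AD i y + AD (suc i) y + AD (2 ℕ.+ i) y
    partition y with distance-total x y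
    ... | j , e =
      -- All three coefficients are `A z y`; at any other distance `y` is not a neighbour of `z`, so
      -- `A z y` vanishes.
      three-term i e (λ _ → ≈-refl) (λ _ → ≈-refl) (λ _ → ≈-refl)
        (λ j≢i j≢1+i j≢2+i → nonadjacent λ z∼y → far d z∼y e j≢i j≢1+i j≢2+i)

  -- The entrywise product rule for distance matrices. The coefficient belonging to each distance of
  -- `z` is the count seen from `z`, hence the shifted indices `b i`, `a (suc i)`, `c (2 ℕ.+ i)`.
  neighboursAt-recurrence : ∀ i x z →
    N (suc i) x z ≈ fromℕ (b i) * distanceMatrix i x z + a (suc i) * distanceMatrix (suc i) x z
                      + fromℕ (c (2 ℕ.+ i)) * distanceMatrix (2 ℕ.+ i) x z
  neighboursAt-recurrence i x z with distance-total x z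
  ... | j , d =
    three-term i d
      (λ { ≡.refl → neighboursAt-b d }) (λ { ≡.refl → neighboursAt-a d }) (λ { ≡.refl → neighboursAt-c d })
      (λ j≢i j≢1+i j≢2+i → neighboursAt-none λ z∼y e → far e (∼-sym z∼y) d j≢i j≢1+i j≢2+i)

  -- The boundary case of the product rule: only `x` is at distance 0, so the count is nonzero only
  -- when `z` is adjacent to `x`.
  neighboursAt-zero : ∀ x z → N 0 x z ≈ fromℕ (c 1) * distanceMatrix 1 x z
  neighboursAt-zero x z with x ∼? z
  ... | yes x∼z = begin
    N 0 x z                               ≈⟨ neighboursAt-c (distance-one x∼z) ⟩
    fromℕ (c 1)                           ≈⟨ *-identityʳ _ ⟨
    fromℕ (c 1) * 1#                      ≈⟨ *-congˡ (at-distance (distance-one x∼z)) ⟨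
    fromℕ (c 1) * distanceMatrix 1 x z    ∎
  ... | no x≁z = begin
    N 0 x z                               ≈⟨ neighboursAt-none (λ { z∼y (≡.refl , _) → x≁z (∼-sym z∼y) }) ⟩
    0#                                    ≈⟨ zeroʳ _ ⟨
    fromℕ (c 1) * 0#                      ≈⟨ *-congˡ (not-at-distance {1} {x} {z} λ { ((_ , x∼z , ≡.refl) , _) → x≁z x∼z }) ⟨
    fromℕ (c 1) * distanceMatrix 1 x z    ∎

  -- Only `x` itself lies at distance 0 from `x`, so one term of the sum survives.
  c₁≈1 : x ∼ z → fromℕ (c 1) ≈ 1#
  c₁≈1 {x} {z} x∼z = begin
    fromℕ (c 1)                               ≈⟨ neighboursAt-c (distance-one x∼z) ⟨
    N 0 x z                                   ≈⟨ neighboursAt-sum 0 x z ⟩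
    sum (λ y → A z y * distanceMatrix 0 x y)  ≈⟨ sum-single x elsewhere ⟩
    A z x * distanceMatrix 0 x x              ≈⟨ *-cong (adjacent (∼-sym x∼z)) (at-distance {0} {x} {x} distance-zero) ⟩
    1# * 1#                                   ≈⟨ *-identityˡ 1# ⟩
    1#                                        ∎
    where
    elsewhere : ∀ y → x ≢ y → A z y * distanceMatrix 0 x y ≈ 0#
    elsewhere y x≢y = ≈-trans (*-congˡ (not-at-distance {0} {x} {y} (x≢y ∘ proj₁))) (zeroʳ _)

  b-pos : Distance i x y → y ∼ z → Distance (suc i) x z → 0# < fromℕ (b i)
  b-pos d y∼z e = <-respʳ-≈ (neighboursAt-b d) (neighboursAt-pos y∼z e)

  c-pos : Distance i x y → y ∼ z → Distance (suc i) x z → 0# < fromℕ (c (suc i))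
  c-pos d y∼z e = <-respʳ-≈ (neighboursAt-c e) (neighboursAt-pos (∼-sym y∼z) d)

  -- Some pair attains distance `D`, and from there no neighbour can be farther away.
  b-diameter≈0 : fromℕ (b D) ≈ 0#
  b-diameter≈0 with diameter
  ... | bound , x , y , d = ≈-trans (≈-sym (neighboursAt-b d))
    (neighboursAt-none λ _ e → contradiction (bound e) (ℕ.<⇒≱ (ℕ.n<1+n D)))

  -- At a distance that occurs, `a` is a neighbour count.
  0≤a : Distance (suc i) x y → 0# ≤ a (suc i)
  0≤a {i} {x} {y} d a<0 = 0≤fromℕ (neighboursAt (suc i) x y) (<-respˡ-≈ (≈-sym (neighboursAt-a d)) a<0)

  -- Sums of an eigenvector over the spheres around a vertex.

  record IsDistanceSums (θ : Carrier) (S : ℕ → Carrier) : Set (r ⊔ ℓ₁) where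
    field
      at-zero         : S 0 ≈ 1#
      recurrence-zero : θ * S 0 ≈ fromℕ (c 1) * S 1
      recurrence-suc  : ∀ i → θ * S (suc i) ≈
        fromℕ (b i) * S i + a (suc i) * S (suc i) + fromℕ (c (2 ℕ.+ i)) * S (2 ℕ.+ i)
      beyond-diameter : D ℕ.< i → S i ≈ 0#

  module EigenvectorSums {θ : Carrier} (v : Vertex → Carrier) (x : Vertex) (v[x]≈1 : v x ≈ 1#)
                         (Av≈θv : ∀ y → sum (λ z → A y z * v z) ≈ θ * v y) where

    distanceSum : ℕ → Carrier
    distanceSum i = sum (λ y → distanceMatrix i x y * v y)

    weighted : ∀ α i → sum (λ y → α * distanceMatrix i x y * v y) ≈ α * distanceSum i
    weighted α i = ≈-trans (sum-cong-≋ λ y → *-assoc α _ (v y)) (≈-sym (*-distribˡ-sum {order} α _))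

    -- A is symmetric, so it can be moved from v to the indicator of the i-th sphere around x.
    θ*distanceSum : ∀ i → θ * distanceSum i ≈ sum (λ z → N i x z * v z)
    θ*distanceSum i = begin
      θ * distanceSum i
        ≈⟨ *-distribˡ-sum {order} θ _ ⟩
      sum (λ y → θ * (dᵢ y * v y))
        ≈⟨ sum-cong-≋ (λ y → solve 3 (λ θ d v → θ :* (d :* v) := d :* (θ :* v)) ≈-refl θ (dᵢ y) (v y)) ⟩
      sum (λ y → dᵢ y * (θ * v y))
        ≈⟨ sum-cong-≋ (λ y → *-congˡ (Av≈θv y)) ⟨
      sum (λ y → dᵢ y * sum (λ z → A y z * v z))
        ≈⟨ sum-cong-≋ (λ y → *-distribˡ-sum {order} (dᵢ y) _) ⟩
      sum (λ y → sum (λ z → dᵢ y * (A y z * v z)))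
        ≈⟨ ∑-comm (λ y z → dᵢ y * (A y z * v z)) ⟩
      sum (λ z → sum (λ y → dᵢ y * (A y z * v z)))
        ≈⟨ sum-cong-≋ (λ z → sum-cong-≋ λ y → transpose y z) ⟩
      sum (λ z → sum (λ y → A z y * dᵢ y * v z))
        ≈⟨ sum-cong-≋ (λ z → *-distribʳ-sum {order} (v z) _) ⟨
      sum (λ z → sum (λ y → A z y * dᵢ y) * v z)
        ≈⟨ sum-cong-≋ (λ z → *-congʳ (neighboursAt-sum i x z)) ⟨
      sum (λ z → N i x z * v z)
        ∎
      where
      dᵢ : Vertex → Carrier
      dᵢ = distanceMatrix i x

      transpose : ∀ y z → dᵢ y * (A y z * v z) ≈ A z y * dᵢ y * v z
      transpose y z = ≈-trans (*-congˡ (*-congʳ (adjacencyMatrix-sym y z)))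
        (solve 3 (λ d a v → d :* (a :* v) := a :* d :* v) ≈-refl (dᵢ y) (A z y) (v z))

    -- Pairing the recurrence for neighbour counts with `v` turns indicators into sphere sums;
    -- `θ*distanceSum` supplies the left-hand sides. Spheres beyond the diameter are empty.
    isDistanceSums : IsDistanceSums θ distanceSum
    isDistanceSums = record
      { at-zero         = begin
          distanceSum 0                ≈⟨ sum-single x (λ y x≢y →
                                            ≈-trans (*-congʳ (not-at-distance {i = 0} {x} {y} (x≢y ∘ proj₁))) (zeroˡ _)) ⟩
          distanceMatrix 0 x x * v x   ≈⟨ *-cong (at-distance {0} {x} {x} distance-zero) v[x]≈1 ⟩
          1# * 1#                      ≈⟨ *-identityˡ 1# ⟩
          1#                           ∎
      ; recurrence-zero = begin
          θ * distanceSum 0            ≈⟨ θ*distanceSum 0 ⟩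
          sum (λ z → N 0 x z * v z)    ≈⟨ sum-cong-≋ (λ z → *-congʳ (neighboursAt-zero x z)) ⟩
          _                            ≈⟨ weighted (fromℕ (c 1)) 1 ⟩
          fromℕ (c 1) * distanceSum 1  ∎
      ; recurrence-suc  = λ i →
          let α = fromℕ (b i) ; β = a (suc i) ; γ = fromℕ (c (2 ℕ.+ i))
              dv : Carrier → ℕ → Vertex → Carrier
              dv = λ δ j z → δ * distanceMatrix j x z * v z
          in begin
          θ * distanceSum (suc i)
            ≈⟨ θ*distanceSum (suc i) ⟩
          sum (λ z → N (suc i) x z * v z)
            ≈⟨ sum-cong-≋ (λ z → ≈-trans (*-congʳ (neighboursAt-recurrence i x z))
                                 (≈-trans (distribʳ (v z) _ _) (+-congʳ (distribʳ (v z) _ _)))) ⟩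
          sum (λ z → dv α i z + dv β (suc i) z + dv γ (2 ℕ.+ i) z)
            ≈⟨ ∑-distrib-+ (λ z → dv α i z + dv β (suc i) z) (dv γ (2 ℕ.+ i)) ⟩
          sum (λ z → dv α i z + dv β (suc i) z) + sum (dv γ (2 ℕ.+ i))
            ≈⟨ +-congʳ (∑-distrib-+ (dv α i) (dv β (suc i))) ⟩
          sum (dv α i) + sum (dv β (suc i)) + sum (dv γ (2 ℕ.+ i))
            ≈⟨ +-cong (+-cong (weighted α i) (weighted β (suc i))) (weighted γ (2 ℕ.+ i)) ⟩
          α * distanceSum i + β * distanceSum (suc i) + γ * distanceSum (2 ℕ.+ i)
            ∎
      ; beyond-diameter = λ {i} D<i → sum-zero {order} λ y →
          ≈-trans (*-congʳ (not-at-distance {i} {x} {y} λ d → ℕ.<⇒≱ D<i (proj₁ diameter d))) (zeroˡ _)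
      }

  -- The entry apart from 0 is invertible, so the eigenvector can be scaled to be 1 there, and that
  -- vertex becomes the centre of the spheres.
  eigenvalue⇒distanceSums : ∀ {θ} → IsEigenvalue A θ → ∃[ S ] IsDistanceSums θ S
  eigenvalue⇒distanceSums {θ} (v , (x , v[x]#0) , Av≈θv) = let w , v[x]w≈1 = #0⇒inverse v[x]#0 in
    _ , EigenvectorSums.isDistanceSums (λ y → v y * w) x v[x]w≈1 λ y → begin
      sum (λ z → A y z * (v z * w))  ≈⟨ sum-cong-≋ (λ z → *-assoc (A y z) (v z) w) ⟨
      sum (λ z → A y z * v z * w)    ≈⟨ *-distribʳ-sum {order} w _ ⟨
      sum (λ z → A y z * v z) * w    ≈⟨ *-congʳ (Av≈θv y) ⟩
      θ * v y * w                    ≈⟨ *-assoc θ (v y) w ⟩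
      θ * (v y * w)                  ∎

  valency-isEigenvalue : IsEigenvalue A (fromℕ valency)
  -- The all-ones vector works because every row of `A` sums to the valency; the diameter supplies a
  -- vertex at which it is nonzero.
  valency-isEigenvalue = (λ _ → 1#) , (proj₁ (proj₂ diameter) , 1#0) , λ y → begin
    sum (λ z → A y z * 1#)  ≈⟨ sum-cong-≋ (λ z → *-identityʳ (A y z)) ⟩
    sum (A y)               ≈⟨ degree-sum y ⟩
    fromℕ valency           ≈⟨ *-identityʳ _ ⟨
    fromℕ valency * 1#      ∎

-- The intersection matrix for diameter three, as pure real arithmetic.

module QuotientMatrix (ℝ : Reals r ℓ₁ ℓ₂ ℓ₃) where
  open Reals ℝ
  open RealProperties ℝ
  open SetoidReasoning setoid
  open SemiringSolver commutativeSemiring using (Polynomial; solve; _:=_; _:+_; _:*_; con)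

  private
    -- Spelled like the unfolding of `fromℕ 2` and `fromℕ 4`, so that solved identities match them
    -- by computation.
    :2 :4 : ∀ {n} → Polynomial n
    :2 = con 1 :+ (con 1 :+ con 0)
    :4 = con 1 :+ (con 1 :+ :2)

  -- The intersection numbers as reals, with `c₁ = 1`, `b₀ = k` and `b₃ = 0` already substituted, so
  -- that no graph is mentioned.
  record IntersectionArray₃ : Set (r ⊔ ℓ₁ ⊔ ℓ₃) where
    field
      k a₁ a₂ a₃ b₁ b₂ c₂ c₃ : Carrier
      a₁+1+b₁≈k  : a₁ + 1# + b₁ ≈ k
      a₂+c₂+b₂≈k : a₂ + c₂ + b₂ ≈ k
      a₃+c₃≈k    : a₃ + c₃ ≈ k
      0<k  : 0# < k
      0<b₁ : 0# < b₁
      0<b₂ : 0# < b₂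
      0<c₂ : 0# < c₂
      0<c₃ : 0# < c₃
      0≤a₃ : 0# ≤ a₃

  module _ (array : IntersectionArray₃) where
    open IntersectionArray₃ array

    -- (1, θ, S₂, S₃) is an eigenvector of the (transposed) tridiagonal intersection matrix.
    record IsQuotientEigenvalue (θ S₂ S₃ : Carrier) : Set ℓ₁ where
      field
        equation₁ : θ * θ ≈ k + a₁ * θ + c₂ * S₂
        equation₂ : θ * S₂ ≈ b₁ * θ + a₂ * S₂ + c₃ * S₃
        equation₃ : θ * S₃ ≈ b₂ * S₂ + a₃ * S₃

      -- On adding the three equations and the trivial `θ * 1# = θ`, the coefficients of each entry
      -- total `k`, so `θ` and `k` multiply the sum to the same value.
      sum≈0 : θ # k → 1# + θ + S₂ + S₃ ≈ 0#
      sum≈0 θ#k = #∧*-equal⇒≈0 θ#k (begin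
        θ * (1# + θ + S₂ + S₃)
          ≈⟨ solve 3 (λ θ S₂ S₃ → θ :* (con 1 :+ θ :+ S₂ :+ S₃) := θ :+ θ :* θ :+ θ :* S₂ :+ θ :* S₃) ≈-refl θ S₂ S₃ ⟩
        θ + θ * θ + θ * S₂ + θ * S₃
          ≈⟨ +-cong (+-cong (+-congˡ equation₁) equation₂) equation₃ ⟩
        θ + (k + a₁ * θ + c₂ * S₂) + (b₁ * θ + a₂ * S₂ + c₃ * S₃) + (b₂ * S₂ + a₃ * S₃)
          ≈⟨ solve 11 (λ θ S₂ S₃ k a₁ a₂ a₃ b₁ b₂ c₂ c₃ →
               θ :+ (k :+ a₁ :* θ :+ c₂ :* S₂) :+ (b₁ :* θ :+ a₂ :* S₂ :+ c₃ :* S₃) :+ (b₂ :* S₂ :+ a₃ :* S₃)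
                 := k :+ (a₁ :+ con 1 :+ b₁) :* θ :+ (a₂ :+ c₂ :+ b₂) :* S₂ :+ (a₃ :+ c₃) :* S₃)
               ≈-refl θ S₂ S₃ k a₁ a₂ a₃ b₁ b₂ c₂ c₃ ⟩
        k + (a₁ + 1# + b₁) * θ + (a₂ + c₂ + b₂) * S₂ + (a₃ + c₃) * S₃
          ≈⟨ +-cong (+-cong (+-congˡ (*-congʳ a₁+1+b₁≈k)) (*-congʳ a₂+c₂+b₂≈k)) (*-congʳ a₃+c₃≈k) ⟩
        k + k * θ + k * S₂ + k * S₃
          ≈⟨ solve 4 (λ θ S₂ S₃ k → k :+ k :* θ :+ k :* S₂ :+ k :* S₃ := k :* (con 1 :+ θ :+ S₂ :+ S₃)) ≈-refl θ S₂ S₃ k ⟩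
        k * (1# + θ + S₂ + S₃) ∎)

      S₂≈0⇒quadratic : S₂ ≈ 0# → θ * θ ≈ k + a₁ * θ
      S₂≈0⇒quadratic S₂≈0 = begin
        θ * θ                   ≈⟨ equation₁ ⟩
        k + a₁ * θ + c₂ * S₂    ≈⟨ +-congˡ (≈-trans (*-congˡ S₂≈0) (zeroʳ c₂)) ⟩
        k + a₁ * θ + 0#         ≈⟨ +-identityʳ _ ⟩
        k + a₁ * θ              ∎

      quadratic⇒S₂≈0 : θ * θ ≈ k + a₁ * θ → S₂ ≈ 0#
      quadratic⇒S₂≈0 quadratic = x*y≈0⇒y≈0 (0<⇒#0 0<c₂) (+-cancelˡ (k + a₁ * θ) _ _ (begin
        k + a₁ * θ + c₂ * S₂    ≈⟨ equation₁ ⟨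
        θ * θ                   ≈⟨ quadratic ⟩
        k + a₁ * θ              ≈⟨ +-identityʳ _ ⟨
        k + a₁ * θ + 0#         ∎))

      -- In `equation₃` the two `S₃` terms become equal and cancel, leaving `b₂ * S₂ ≈ 0#`.
      θ≈a₃⇒S₂≈0 : θ ≈ a₃ → S₂ ≈ 0#
      θ≈a₃⇒S₂≈0 θ≈a₃ = x*y≈0⇒y≈0 (0<⇒#0 0<b₂) (+-cancelʳ (a₃ * S₃) _ _ (begin
        b₂ * S₂ + a₃ * S₃       ≈⟨ equation₃ ⟨
        θ * S₃                  ≈⟨ *-congʳ θ≈a₃ ⟩
        a₃ * S₃                 ≈⟨ +-identityˡ _ ⟨
        0# + a₃ * S₃            ∎))

      S₂≈0∧S₃≈0⇒θ≈0 : S₂ ≈ 0# → S₃ ≈ 0# → θ ≈ 0#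
      S₂≈0∧S₃≈0⇒θ≈0 S₂≈0 S₃≈0 = x*y≈0⇒y≈0 (0<⇒#0 0<b₁) (begin
        b₁ * θ                         ≈⟨ solve 3 (λ x a c → x := x :+ a :* con 0 :+ c :* con 0) ≈-refl (b₁ * θ) a₂ c₃ ⟩
        b₁ * θ + a₂ * 0# + c₃ * 0#     ≈⟨ +-cong (+-congˡ (*-congˡ S₂≈0)) (*-congˡ S₃≈0) ⟨
        b₁ * θ + a₂ * S₂ + c₃ * S₃     ≈⟨ equation₂ ⟨
        θ * S₂                         ≈⟨ *-congˡ S₂≈0 ⟩
        θ * 0#                         ≈⟨ zeroʳ θ ⟩
        0#                             ∎)

      -- The quadratic in factored form: since `k` is positive, `θ` is apart from 0 and, once `θ` is
      -- known to be positive, so is `θ - a₁`.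
      S₂≈0⇒θ*[θ-a₁]≈k : S₂ ≈ 0# → θ * (θ - a₁) ≈ k
      S₂≈0⇒θ*[θ-a₁]≈k S₂≈0 = +-cancelʳ (a₁ * θ) _ _ (begin
        θ * (θ - a₁) + a₁ * θ    ≈⟨ solve 3 (λ θ e a → θ :* e :+ a :* θ := θ :* (e :+ a)) ≈-refl θ (θ - a₁) a₁ ⟩
        θ * (θ - a₁ + a₁)        ≈⟨ *-congˡ (//-rightDividesˡ a₁ θ) ⟩
        θ * θ                    ≈⟨ S₂≈0⇒quadratic S₂≈0 ⟩
        k + a₁ * θ               ∎)

      S₂≈0⇒θ#0 : S₂ ≈ 0# → θ # 0#
      S₂≈0⇒θ#0 S₂≈0 = x*y#0⇒y#0 (0<⇒#0 (<-respʳ-≈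
        (≈-trans (≈-sym (S₂≈0⇒θ*[θ-a₁]≈k S₂≈0)) (*-comm θ _)) 0<k))

      -- Tightness reduces the equality to refuting `θ # a₃`. Under that assumption `equation₃`
      -- forces `S₃ ≈ 0#` and then `equation₂` forces `θ ≈ 0#`, but `θ` is apart from 0.
      S₂≈0⇒θ≈a₃ : S₂ ≈ 0# → θ ≈ a₃
      S₂≈0⇒θ≈a₃ S₂≈0 = proj₁ (tight θ a₃) λ θ#a₃ →
        #-irrefl (S₂≈0∧S₃≈0⇒θ≈0 S₂≈0 (#∧*-equal⇒≈0 θ#a₃ (begin
          θ * S₃               ≈⟨ equation₃ ⟩
          b₂ * S₂ + a₃ * S₃    ≈⟨ +-congʳ (≈-trans (*-congˡ S₂≈0) (zeroʳ b₂)) ⟩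
          0# + a₃ * S₃         ≈⟨ +-identityˡ _ ⟩
          a₃ * S₃              ∎))) (S₂≈0⇒θ#0 S₂≈0)

      S₂≈0⇒0<θ : S₂ ≈ 0# → 0# < θ
      S₂≈0⇒0<θ S₂≈0 = 0≤∧#0⇒0< (λ θ<0 → 0≤a₃ (<-respˡ-≈ (S₂≈0⇒θ≈a₃ S₂≈0) θ<0)) (S₂≈0⇒θ#0 S₂≈0)

      S₂≈0⇒0<θ-a₁ : S₂ ≈ 0# → 0# < θ - a₁
      S₂≈0⇒0<θ-a₁ S₂≈0 = *-cancelˡ-pos (S₂≈0⇒0<θ S₂≈0) (<-respʳ-≈ (≈-sym (S₂≈0⇒θ*[θ-a₁]≈k S₂≈0)) 0<k)

      -- Here `θ` equals `a₃`, which falls short of `k` by the positive number `c₃`.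
      S₂≈0⇒θ<k : S₂ ≈ 0# → θ < k
      S₂≈0⇒θ<k S₂≈0 = <-respˡ-≈ (≈-sym (S₂≈0⇒θ≈a₃ S₂≈0)) (<-respʳ-≈ a₃+c₃≈k (x<x+y a₃ 0<c₃))

      -- The square root is a witness `s` pinned down by `IsSqrt`, matching the third condition of
      -- the theorem.
      IsLargerRoot : Set (r ⊔ ℓ₁ ⊔ ℓ₃)
      IsLargerRoot = ∃[ s ] (IsSqrt (a₁ * a₁ + fromℕ 4 * k) s × θ ≈ (a₁ + s) / 2)

      -- The root is s = θ + (θ - a₁), the difference of the roots θ and a₁ - θ of the quadratic.
      S₂≈0⇒isLargerRoot : S₂ ≈ 0# → IsLargerRoot
      S₂≈0⇒isLargerRoot S₂≈0 = θ + e , ((λ s<0 → <-irrefl ≈-refl (<-trans s<0 0<s)) , s²) ,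
        *-cancelˡ (fromℕ#0 2) (begin
          fromℕ 2 * θ                  ≈⟨ solve 1 (λ θ → :2 :* θ := θ :+ θ) ≈-refl θ ⟩
          θ + θ                        ≈⟨ +-congʳ (//-rightDividesˡ a₁ θ) ⟨
          e + a₁ + θ                   ≈⟨ solve 3 (λ θ e a → e :+ a :+ θ := a :+ (θ :+ e)) ≈-refl θ e a₁ ⟩
          a₁ + (θ + e)                 ≈⟨ /-*-cancel _ 2 ⟨
          (a₁ + (θ + e)) / 2 * fromℕ 2 ≈⟨ *-comm _ _ ⟩
          fromℕ 2 * ((a₁ + (θ + e)) / 2) ∎)
        where
        e : Carrier
        e = θ - a₁

        0<s : 0# < θ + e
        0<s = +-pos (S₂≈0⇒0<θ S₂≈0) (S₂≈0⇒0<θ-a₁ S₂≈0)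

        s² : (θ + e) * (θ + e) ≈ a₁ * a₁ + fromℕ 4 * k
        s² = begin
          (θ + e) * (θ + e)
            -- Writing `θ` as `e + a₁` removes the subtraction, so the next identity is one of
            -- commutative semirings.
            ≈⟨ *-cong (+-congʳ (//-rightDividesˡ a₁ θ)) (+-congʳ (//-rightDividesˡ a₁ θ)) ⟨
          (e + a₁ + e) * (e + a₁ + e)
            ≈⟨ solve 2 (λ e a → (e :+ a :+ e) :* (e :+ a :+ e)
                 := a :* a :+ :4 :* ((e :+ a) :* e)) ≈-refl e a₁ ⟩
          a₁ * a₁ + fromℕ 4 * ((e + a₁) * e)
            ≈⟨ +-congˡ (*-congˡ (*-congʳ (//-rightDividesˡ a₁ θ))) ⟩
          a₁ * a₁ + fromℕ 4 * (θ * e)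
            ≈⟨ +-congˡ (*-congˡ (S₂≈0⇒θ*[θ-a₁]≈k S₂≈0)) ⟩
          a₁ * a₁ + fromℕ 4 * k ∎

      -- Doubling clears the fraction: `(2θ)² = (a₁ + s)²`, and substituting the value of `s²`
      -- leaves four times the quadratic.
      isLargerRoot⇒S₂≈0 : IsLargerRoot → S₂ ≈ 0#
      isLargerRoot⇒S₂≈0 (s , (_ , s²) , θ≈[a₁+s]/2) = quadratic⇒S₂≈0 (*-cancelˡ (fromℕ#0 4) (begin
        fromℕ 4 * (θ * θ)
          ≈⟨ solve 1 (λ θ → :4 :* (θ :* θ) := (θ :* :2) :* (θ :* :2)) ≈-refl θ ⟩
        θ * fromℕ 2 * (θ * fromℕ 2)
          ≈⟨ *-cong 2θ 2θ ⟩
        (a₁ + s) * (a₁ + s)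
          ≈⟨ solve 2 (λ a s → (a :+ s) :* (a :+ s) := a :* a :+ :2 :* a :* s :+ s :* s) ≈-refl a₁ s ⟩
        a₁ * a₁ + fromℕ 2 * a₁ * s + s * s
          ≈⟨ +-congˡ s² ⟩
        a₁ * a₁ + fromℕ 2 * a₁ * s + (a₁ * a₁ + fromℕ 4 * k)
          ≈⟨ solve 3 (λ a s k → a :* a :+ :2 :* a :* s :+ (a :* a :+ :4 :* k)
                               := :4 :* k :+ :2 :* a :* (a :+ s)) ≈-refl a₁ s k ⟩
        fromℕ 4 * k + fromℕ 2 * a₁ * (a₁ + s)
          ≈⟨ +-congˡ (*-congˡ 2θ) ⟨
        fromℕ 4 * k + fromℕ 2 * a₁ * (θ * fromℕ 2)
          ≈⟨ solve 3 (λ a θ k → :4 :* k :+ :2 :* a :* (θ :* :2) := :4 :* (k :+ a :* θ)) ≈-refl a₁ θ k ⟩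
        fromℕ 4 * (k + a₁ * θ) ∎))
        where
        2θ : θ * fromℕ 2 ≈ a₁ + s
        2θ = ≈-trans (*-congʳ θ≈[a₁+s]/2) (/-*-cancel (a₁ + s) 2)

    -- Comparison of `θ` with the other eigenvalues.

    open IsQuotientEigenvalue

    -- Beyond θ all of 1, ν, T₂, T₃ are positive, so they cannot sum to zero.
    nonprincipal≤ : ∀ {θ S₂ S₃ ν T₂ T₃} → IsQuotientEigenvalue θ S₂ S₃ → S₂ ≈ 0# →
                    IsQuotientEigenvalue ν T₂ T₃ → ν # k → ν ≤ θ
    nonprincipal≤ {θ} {ν = ν} {T₂} {T₃} Q S₂≈0 R ν#k θ<ν =
      0<⇒≉0 (+-pos (+-pos (+-pos 0<1 0<ν) 0<T₂) 0<T₃) (sum≈0 R ν#k)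
      where
      d e : Carrier
      d = ν - θ
      e = θ - a₁

      0<d : 0# < d
      0<d = x<y⇒0<y-x θ<ν

      0<ν : 0# < ν
      0<ν = <-trans (S₂≈0⇒0<θ Q S₂≈0) θ<ν

      -- Subtract the quadratic at `θ` from `equation₁` at `ν`: the difference factors as
      -- `(ν - θ) * (ν + θ - a₁)`.
      c₂T₂ : c₂ * T₂ ≈ d * (ν + e)
      c₂T₂ = +-cancelˡ (k + a₁ * ν) _ _ (begin
        k + a₁ * ν + c₂ * T₂
          ≈⟨ equation₁ R ⟨
        ν * ν
          ≈⟨ *-congˡ (//-rightDividesˡ θ ν) ⟨
        ν * (d + θ)
          ≈⟨ *-congˡ (+-congˡ (//-rightDividesˡ a₁ θ)) ⟨
        ν * (d + (e + a₁))
          ≈⟨ solve 4 (λ ν d e a → ν :* (d :+ (e :+ a)) := ν :* e :+ a :* ν :+ d :* ν) ≈-refl ν d e a₁ ⟩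
        ν * e + a₁ * ν + d * ν
          ≈⟨ +-congʳ (+-congʳ (*-congʳ (//-rightDividesˡ θ ν))) ⟨
        (d + θ) * e + a₁ * ν + d * ν
          ≈⟨ solve 5 (λ ν d e a θ → (d :+ θ) :* e :+ a :* ν :+ d :* ν := θ :* e :+ a :* ν :+ d :* (ν :+ e)) ≈-refl ν d e a₁ θ ⟩
        θ * e + a₁ * ν + d * (ν + e)
          ≈⟨ +-congʳ (+-congʳ (S₂≈0⇒θ*[θ-a₁]≈k Q S₂≈0)) ⟩
        k + a₁ * ν + d * (ν + e) ∎)

      0<T₂ : 0# < T₂
      0<T₂ = *-cancelˡ-pos 0<c₂ (<-respʳ-≈ (≈-sym c₂T₂) (*-pos 0<d (+-pos 0<ν (S₂≈0⇒0<θ-a₁ Q S₂≈0))))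

      -- Because `a₃` equals `θ`, moving `a₃ * T₃` to the left of `equation₃` for `ν` leaves the
      -- factor `ν - θ`.
      dT₃ : d * T₃ ≈ b₂ * T₂
      dT₃ = +-cancelʳ (a₃ * T₃) _ _ (begin
        d * T₃ + a₃ * T₃      ≈⟨ +-congˡ (*-congʳ (S₂≈0⇒θ≈a₃ Q S₂≈0)) ⟨
        d * T₃ + θ * T₃       ≈⟨ distribʳ T₃ d θ ⟨
        (d + θ) * T₃          ≈⟨ *-congʳ (//-rightDividesˡ θ ν) ⟩
        ν * T₃                ≈⟨ equation₃ R ⟩
        b₂ * T₂ + a₃ * T₃     ∎)

      0<T₃ : 0# < T₃
      0<T₃ = *-cancelˡ-pos 0<d (<-respʳ-≈ (≈-sym dT₃) (*-pos 0<b₂ 0<T₂))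

    -- Since θ < k, either ν < k or θ < ν; in the latter case ν # k is refuted, so ν ≈ k by tightness.
    principal-or-≤ : ∀ {θ S₂ S₃ ν T₂ T₃} → IsQuotientEigenvalue θ S₂ S₃ → S₂ ≈ 0# →
                     IsQuotientEigenvalue ν T₂ T₃ → ν ≈ k ⊎ ν ≤ θ
    principal-or-≤ {θ} {ν = ν} Q S₂≈0 R =
      [ [ above , (λ ν<θ → inj₂ λ θ<ν → <-irrefl ≈-refl (<-trans θ<ν ν<θ)) ]′ ∘ #⇒<⊎>
      , inj₂ ∘ nonprincipal≤ Q S₂≈0 R
      ]′ (#-cotrans (<⇒# (S₂≈0⇒θ<k Q S₂≈0)) ν)
      where
      above : θ < ν → ν ≈ k ⊎ ν ≤ θ
      above θ<ν = inj₁ (proj₁ (tight ν k) λ ν#k → nonprincipal≤ Q S₂≈0 R ν#k θ<ν)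

-- From graphs of diameter three to the real equations.

module DiameterThree (ℝ : Reals r ℓ₁ ℓ₂ ℓ₃) {Γ : Graph} {b c : ℕ → ℕ} (dr : IsDistanceRegular Γ 3 b c) where
  open Reals ℝ
  open RealProperties ℝ
  open Graph Γ
  open GraphDistance Γ
  open IsDistanceRegular dr
  open DistanceSums ℝ dr
  open QuotientMatrix ℝ
  open SetoidReasoning setoid
  open SemiringSolver commutativeSemiring using (solve; _:=_; _:+_; _:*_; con)

  private
    A : Vertex → Vertex → Carrier
    A = adjacencyMatrix ℝ Γ

    a : ℕ → Carrier
    a = intersectionNumberA ℝ dr

  -- A geodesic between vertices at distance 3, found by stepping back from its end. It witnesses
  -- the positivity of the intersection numbers and that distance 3 occurs.
  path : ∃[ w ] ∃[ x ] ∃[ y ] ∃[ z ]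
         (Distance 1 w x × Distance 2 w y × Distance 3 w z) × (w ∼ x × x ∼ y × y ∼ z)
  path with diameter
  ... | _ , w , z , d₃ with distance-pred d₃
  ... | y , z∼y , d₂ with distance-pred d₂
  ... | x , y∼x , d₁@((_ , w∼x , ≡.refl) , _) =
    w , x , y , z , (d₁ , d₂ , d₃) , w∼x , ∼-sym y∼x , ∼-sym z∼y

  c₁≈1′ : fromℕ (c 1) ≈ 1#
  c₁≈1′ = let _ , _ , _ , _ , _ , w∼x , _ = path in c₁≈1 w∼x

  array : IntersectionArray₃
  array = record
    { k = fromℕ valency ; a₁ = a 1 ; a₂ = a 2 ; a₃ = a 3
    ; b₁ = fromℕ (b 1) ; b₂ = fromℕ (b 2) ; c₂ = fromℕ (c 2) ; c₃ = fromℕ (c 3)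
    ; a₁+1+b₁≈k  = ≈-trans (+-congʳ (+-congˡ (≈-sym c₁≈1′))) (a+c+b≈k 1)
    ; a₂+c₂+b₂≈k = a+c+b≈k 2
    ; a₃+c₃≈k    = begin
        a 3 + fromℕ (c 3)                 ≈⟨ +-identityʳ _ ⟨
        a 3 + fromℕ (c 3) + 0#            ≈⟨ +-congˡ b-diameter≈0 ⟨
        a 3 + fromℕ (c 3) + fromℕ (b 3)   ≈⟨ a+c+b≈k 3 ⟩
        fromℕ valency                     ∎
    -- An edge of `path` leading outwards makes the matching `b` positive; read backwards, it makes
    -- the matching `c` positive.
    ; 0<k  = let _ , _ , _ , _ , (d₁ , _ , _) , w∼x , _ , _ = path in b-pos distance-zero w∼x d₁
    ; 0<b₁ = let _ , _ , _ , _ , (d₁ , d₂ , _) , _ , x∼y , _ = path in b-pos d₁ x∼y d₂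
    ; 0<b₂ = let _ , _ , _ , _ , (_ , d₂ , d₃) , _ , _ , y∼z = path in b-pos d₂ y∼z d₃
    ; 0<c₂ = let _ , _ , _ , _ , (d₁ , d₂ , _) , _ , x∼y , _ = path in c-pos d₁ x∼y d₂
    ; 0<c₃ = let _ , _ , _ , _ , (_ , d₂ , d₃) , _ , _ , y∼z = path in c-pos d₂ y∼z d₃
    ; 0≤a₃ = let _ , _ , _ , _ , (_ , _ , d₃) , _ , _ , _ = path in 0≤a d₃
    }

  open IntersectionArray₃ array using (0<k; 0<b₁)

  distanceSums⇒quotientEigenvalue : ∀ {θ S} → IsDistanceSums θ S →
                                    IsQuotientEigenvalue array θ (S 2) (S 3)
  distanceSums⇒quotientEigenvalue {θ} {S} sums = record
    { equation₁ = begin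
        θ * θ                                                     ≈⟨ *-congˡ S₁≈θ ⟨
        θ * S 1                                                   ≈⟨ recurrence-suc 0 ⟩
        fromℕ valency * S 0 + a 1 * S 1 + fromℕ (c 2) * S 2
          ≈⟨ +-congʳ (+-cong (≈-trans (*-congˡ at-zero) (*-identityʳ _)) (*-congˡ S₁≈θ)) ⟩
        fromℕ valency + a 1 * θ + fromℕ (c 2) * S 2               ∎
    ; equation₂ = begin
        θ * S 2                                                   ≈⟨ recurrence-suc 1 ⟩
        fromℕ (b 1) * S 1 + a 2 * S 2 + fromℕ (c 3) * S 3         ≈⟨ +-congʳ (+-congʳ (*-congˡ S₁≈θ)) ⟩
        fromℕ (b 1) * θ + a 2 * S 2 + fromℕ (c 3) * S 3           ∎
    ; equation₃ = begin
        θ * S 3                                                   ≈⟨ recurrence-suc 2 ⟩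
        fromℕ (b 2) * S 2 + a 3 * S 3 + fromℕ (c 4) * S 4
          -- The index 4 lies beyond the diameter, and the vanishing of `S 4` closes the system.
          ≈⟨ +-congˡ (≈-trans (*-congˡ (beyond-diameter (ℕ.n<1+n 3))) (zeroʳ _)) ⟩
        fromℕ (b 2) * S 2 + a 3 * S 3 + 0#                        ≈⟨ +-identityʳ _ ⟩
        fromℕ (b 2) * S 2 + a 3 * S 3                             ∎
    }
    where
    open IsDistanceSums sums

    S₁≈θ : S 1 ≈ θ
    S₁≈θ = begin
      S 1                  ≈⟨ *-identityˡ _ ⟨
      1# * S 1             ≈⟨ *-congʳ c₁≈1′ ⟨
      fromℕ (c 1) * S 1    ≈⟨ recurrence-zero ⟨
      θ * S 0              ≈⟨ *-congˡ at-zero ⟩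
      θ * 1#               ≈⟨ *-identityʳ θ ⟩
      θ                    ∎

  eigenvalue⇒quotientEigenvalue : ∀ {θ} → IsEigenvalue A θ →
                                  ∃[ S₂ ] ∃[ S₃ ] IsQuotientEigenvalue array θ S₂ S₃
  eigenvalue⇒quotientEigenvalue eigen =
    let _ , sums = eigenvalue⇒distanceSums eigen in _ , _ , distanceSums⇒quotientEigenvalue sums

  -- Relation between sphere sums and the standard sequence.

  module _ {θ S₂ S₃ : Carrier} (quotient : IsQuotientEigenvalue array θ S₂ S₃)
           {u : ℕ → Carrier} (standard : IsStandardSequence ℝ dr θ u) where
    open IsQuotientEigenvalue quotient
    open IsStandardSequence standard

    u₁*k≈θ : u 1 * fromℕ valency ≈ θ
    u₁*k≈θ = ≈-trans (*-congʳ u₁) (/-*-cancel θ valency {{valency-nonZero}})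

    -- Both sides complete `k + a 1 * θ` to `θ * θ`: the left by `equation₁`, the right by `k` times
    -- the recurrence for `u`. This is the case `i = 2` of `S_i = k_i u_i`, where `k_i` counts the
    -- vertices at distance `i` and `c₂ k₂ = k b₁`.
    c₂S₂≈kb₁u₂ : fromℕ (c 2) * S₂ ≈ fromℕ valency * fromℕ (b 1) * u 2
    c₂S₂≈kb₁u₂ = +-cancelˡ (k + a 1 * θ) _ _ (begin
      k + a 1 * θ + fromℕ (c 2) * S₂
        ≈⟨ equation₁ ⟨
      θ * θ
        ≈⟨ *-congˡ u₁*k≈θ ⟨
      θ * (u 1 * k)
        ≈⟨ *-assoc θ (u 1) k ⟨
      θ * u 1 * k
        ≈⟨ *-congʳ (recurrence 0 (ℕ.s≤s (ℕ.s≤s ℕ.z≤n))) ⟨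
      (fromℕ (c 1) * u 0 + a 1 * u 1 + fromℕ (b 1) * u 2) * k
        ≈⟨ *-congʳ (+-congʳ (+-congʳ (*-cong c₁≈1′ u₀))) ⟩
      (1# * 1# + a 1 * u 1 + fromℕ (b 1) * u 2) * k
        ≈⟨ solve 5 (λ a u b v k → (con 1 :* con 1 :+ a :* u :+ b :* v) :* k
             := k :+ a :* (u :* k) :+ k :* b :* v) ≈-refl (a 1) (u 1) (fromℕ (b 1)) (u 2) k ⟩
      k + a 1 * (u 1 * k) + k * fromℕ (b 1) * u 2
        ≈⟨ +-congʳ (+-congˡ (*-congˡ u₁*k≈θ)) ⟩
      k + a 1 * θ + k * fromℕ (b 1) * u 2 ∎)
      where
      k : Carrier
      k = fromℕ valency

    S₂≈0⇒u₂≈0 : S₂ ≈ 0# → u 2 ≈ 0#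
    S₂≈0⇒u₂≈0 S₂≈0 = x*y≈0⇒y≈0 (0<⇒#0 (*-pos 0<k 0<b₁))
      (≈-trans (≈-sym c₂S₂≈kb₁u₂) (≈-trans (*-congˡ S₂≈0) (zeroʳ _)))

    u₂≈0⇒S₂≈0 : u 2 ≈ 0# → S₂ ≈ 0#
    u₂≈0⇒S₂≈0 u₂≈0 = x*y≈0⇒y≈0 (0<⇒#0 (IntersectionArray₃.0<c₂ array))
      (≈-trans c₂S₂≈kb₁u₂ (≈-trans (*-congˡ u₂≈0) (zeroʳ _)))

theorem7 :
    ∀ {r ℓ₁ ℓ₂ ℓ₃} (ℝ : Reals r ℓ₁ ℓ₂ ℓ₃) →
    let open Reals ℝ in
    (Γ : Graph) (b c : ℕ → ℕ) (dr : IsDistanceRegular Γ 3 b c) →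
    let A = adjacencyMatrix ℝ Γ
        a = intersectionNumberA ℝ dr
        k = IsDistanceRegular.valency dr in
    (θ : Carrier) → IsEigenvalue A θ →
    (u : ℕ → Carrier) → IsStandardSequence ℝ dr θ u →
    let i   = u 2 ≈ 0#
        ii  = θ ≈ a 3
        iii = ∃[ s ] (IsSqrt (a 1 * a 1 + fromℕ 4 * fromℕ k) s × θ ≈ (a 1 + s) / 2) in
    ((i ⇔ ii) × (ii ⇔ iii)) × (i → IsSecondLargestEigenvalue A θ)
theorem7 ℝ Γ b c dr θ eigen u standard =
    -- Every implication passes through `S₂ ≈ 0#`.
    ( mk⇔ (S₂≈0⇒θ≈a₃ ∘ u₂⇒S₂) (S₂⇒u₂ ∘ θ≈a₃⇒S₂≈0)
    , mk⇔ (S₂≈0⇒isLargerRoot ∘ θ≈a₃⇒S₂≈0) (S₂≈0⇒θ≈a₃ ∘ isLargerRoot⇒S₂≈0) )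
  -- The eigenvalue above `θ` is the valency; any other `ν` is compared with `θ` through its own
  -- sphere sums.
  , λ u₂≈0 → eigen , fromℕ valency , valency-isEigenvalue , S₂≈0⇒θ<k (u₂⇒S₂ u₂≈0) , λ ν ν-eigen →
      let _ , _ , ν-quotient = eigenvalue⇒quotientEigenvalue ν-eigen in
      principal-or-≤ array quotient (u₂⇒S₂ u₂≈0) ν-quotient
  where
  open Reals ℝ using (fromℕ)
  open IsDistanceRegular dr using (valency)
  open DistanceSums ℝ dr using (valency-isEigenvalue)
  open QuotientMatrix ℝ
  open DiameterThree ℝ dr
  quotient = proj₂ (proj₂ (eigenvalue⇒quotientEigenvalue eigen))
  open IsQuotientEigenvalue quotient
  u₂⇒S₂ = u₂≈0⇒S₂≈0 quotient standard
  S₂⇒u₂ = S₂≈0⇒u₂≈0 quotient standard
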